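{- Let $k$ be an integer and let $G$ be a graph of order $n$ with maximum vertex degree $\Delta$, where $\Delta\ge k\ge 1$. Then $$ L_k(G)\;\ge\;\frac{k\,n}{\tilde c_{k+1}^{\,1/k}\,(1+k)^{1+1/k}},\qquad\text{where } \tilde c_{k+1}=\binom{\Delta+1}{k+1}. $$
   Context: Graphs are finite, simple and undirected. $N[v]$ denotes the closed neighbourhood of a vertex $v$ (the vertex $v$ together with all its neighbours). A vertex set $X\subseteq V(G)$ is a $k$-limited packing of $G$ if $|N[v]\cap X|\le k$ for every vertex $v\in V(G)$. The $k$-limited packing number $L_k(G)$ is the maximum size of a $k$-limited packing in $G$. -}

module Defs where

open import Level using (0ℓ)
import Algebra.Definitions.RawSemiring
open import Data.Empty using (⊥)
open import Data.Fin using (Fin)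
open import Data.Fin.Subset as Subset using (Subset; ⁅_⁆; _∪_; _∩_; ∣_∣)
open import Data.Fin.Subset.Properties using (anySubset?; ∣p∣≤n; ∩-zeroʳ; ∣⊥∣≡0)
open import Data.Fin.Properties using (all?)
open import Data.Integer as ℤ using (+_; -[1+_])
import Data.Integer.Properties as ℤ
import Data.List as List
open import Data.List.Extrema.Nat using (max)
open import Data.Nat as ℕ using (ℕ; zero; suc; z≤n; s≤s)
open import Data.Nat.Combinatorics using (_C_; nCk+nC[k+1]≡[n+1]C[k+1])
import Data.Nat.Coprimality as C
import Data.Nat.Properties as ℕ
open import Data.Product using (∃; ∃₂; _×_; _,_; proj₁; proj₂)
open import Data.Rational as ℚ using (ℚ; 0ℚ; 1ℚ; mkℚ; _+_; _*_; _-_; -_; _<_; _≤_)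
import Data.Rational.Properties as ℚ
open import Data.Rational.Solver using (module +-*-Solver)
open import Data.Rational.Unnormalised as ℚᵘ using (ℚᵘ; mkℚᵘ)
open import Data.Sum using (_⊎_; inj₁; inj₂; [_,_]′)
import Data.Vec as Vec
open import Function using (case_of_)
open import Relation.Binary using (Rel; Symmetric; Decidable; tri<; tri≈; tri>)
open import Relation.Binary.PropositionalEquality
  using (_≡_; refl; sym; trans; cong; subst; subst₂)
open import Relation.Nullary using (¬_; yes; no; does; contradiction)
open import Relation.Nullary.Decidable using (_×-dec_)
import Relation.Unary as Unary

open Algebra.Definitions.RawSemiring ℚ.+-*-rawSemiring using (_^_)

private
  *-monoʳ-< : ∀ {r p q} → 0ℚ < r → p < q → p * r < q * r
  *-monoʳ-< {r} 0<r = ℚ.*-monoˡ-<-pos r {{ℚ.positive 0<r}}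

  *-monoˡ-< : ∀ {r p q} → 0ℚ < r → p < q → r * p < r * q
  *-monoˡ-< {r} 0<r = ℚ.*-monoʳ-<-pos r {{ℚ.positive 0<r}}

  *-mono-< : ∀ {p q r s} → 0ℚ < p → 0ℚ < s → p < q → r < s → p * r < q * s
  *-mono-< 0<p 0<s p<q r<s = ℚ.<-trans (*-monoˡ-< 0<p r<s) (*-monoʳ-< 0<s p<q)

  *-pos : ∀ {p q} → 0ℚ < p → 0ℚ < q → 0ℚ < p * q
  *-pos {p} {q} 0<p 0<q = subst (_< p * q) (ℚ.*-zeroˡ q) (*-monoʳ-< 0<q 0<p)

  *-cancelʳ-< : ∀ {r p q} → 0ℚ < r → p * r < q * r → p < q
  *-cancelʳ-< {r} 0<r = ℚ.*-cancelʳ-<-nonNeg r {{ℚ.nonNegative (ℚ.<⇒≤ 0<r)}}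

  +-pos : ∀ {p q} → 0ℚ < p → 0ℚ < q → 0ℚ < p + q
  +-pos {p} {q} 0<p 0<q = subst (_< p + q) (ℚ.+-identityˡ 0ℚ) (ℚ.+-mono-< 0<p 0<q)

  p<p+q : ∀ {p q} → 0ℚ < q → p < p + q
  p<p+q {p} {q} 0<q = subst (_< p + q) (ℚ.+-identityʳ p) (ℚ.+-monoʳ-< p 0<q)

  p-1<p : ∀ p → p - 1ℚ < p
  p-1<p p = subst (p - 1ℚ <_) (ℚ.+-identityʳ p) (ℚ.+-monoʳ-< p (ℚ.negative⁻¹ (- 1ℚ)))

  0<1 : 0ℚ < 1ℚ
  0<1 = ℚ.positive⁻¹ 1ℚ

  p<q⇒0<q-p : ∀ {p q} → p < q → 0ℚ < q - p
  p<q⇒0<q-p {p} {q} p<q = subst (_< q - p) (ℚ.+-inverseʳ p) (ℚ.+-monoˡ-< (- p) p<q)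

  abstract
    quotient : ∀ p {q} → 0ℚ < q → ∃ λ t → t * q ≡ p
    quotient p {q} 0<q = p * (ℚ.1/ q) , trans (ℚ.*-assoc p _ q)
      (trans (cong (p *_) (ℚ.*-inverseˡ q)) (ℚ.*-identityʳ p))
      where instance q≢0 : ℚ.NonZero q
                     q≢0 = ℚ.>-nonZero 0<q

    quotient⁺ : ∀ {p q} → 0ℚ < p → 0ℚ < q → ∃ λ t → 0ℚ < t × t * q ≡ p
    quotient⁺ {p} {q} 0<p 0<q with quotient p 0<q
    ... | t , eq = t , *-cancelʳ-< 0<q (subst₂ _<_ (sym (ℚ.*-zeroˡ q)) (sym eq) 0<p) , eq

  ^-pos : ∀ {p} n → 0ℚ < p → 0ℚ < p ^ n
  ^-pos zero    0<p = 0<1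
  ^-pos (suc n) 0<p = *-pos 0<p (^-pos n 0<p)

  ^-mono-< : ∀ {p q} n → 0ℚ < p → p < q → p ^ suc n < q ^ suc n
  ^-mono-< {p} {q} zero    0<p p<q =
    subst₂ _<_ (sym (ℚ.*-identityʳ p)) (sym (ℚ.*-identityʳ q)) p<q
  ^-mono-< (suc n) 0<p p<q =
    *-mono-< 0<p (^-pos (suc n) (ℚ.<-trans 0<p p<q)) p<q (^-mono-< n 0<p p<q)

  ^-small : ∀ {p} n → 0ℚ < p → p < 1ℚ → p ^ suc n ≤ p
  ^-small {p} zero    0<p p<1 = ℚ.≤-reflexive (ℚ.*-identityʳ p)
  ^-small {p} (suc n) 0<p p<1 = subst (p * p ^ suc n ≤_) (ℚ.*-identityʳ p)
    (ℚ.<⇒≤ (*-monoˡ-< 0<p (ℚ.≤-<-trans (^-small n 0<p p<1) p<1)))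

  ^-large : ∀ {p} n → 1ℚ < p → p ≤ p ^ suc n
  ^-large {p} zero    1<p = ℚ.≤-reflexive (sym (ℚ.*-identityʳ p))
  ^-large {p} (suc n) 1<p = subst (_≤ p * p ^ suc n) (ℚ.*-identityʳ p)
    (ℚ.<⇒≤ (*-monoˡ-< (ℚ.<-trans 0<1 1<p) (ℚ.<-≤-trans 1<p (^-large n 1<p))))

  below-both : ∀ {p q} → 0ℚ < p → 0ℚ < q → ∃ λ t → 0ℚ < t × t < p × t < q
  below-both {p} {q} 0<p 0<q with ℚ.≤-total p q
  ... | inj₁ p≤q = let t , 0<t , t<p = ℚ.<-dense 0<p in t , 0<t , t<p , ℚ.<-≤-trans t<p p≤q
  ... | inj₂ q≤p = let t , 0<t , t<q = ℚ.<-dense 0<q in t , 0<t , ℚ.<-≤-trans t<q q≤p , t<q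

  ι : ℕ → ℚ
  ι zero    = 0ℚ
  ι (suc n) = 1ℚ + ι n

  1-coprime : ∀ n → C.Coprime n 1
  1-coprime n = C.sym (C.1-coprimeTo n)

  ι≡ : ∀ n → ι n ≡ mkℚ (+ n) 0 (1-coprime n)
  ι≡ zero    = refl
  ι≡ (suc n) = trans (cong (λ x → 1ℚ + x) (ι≡ n))
    (trans (ℚ./-cong {q₁ = 1} {q₂ = 1} (cong (λ x → + 1 ℤ.+ x) (ℤ.*-identityʳ (+ n))) refl)
           (ℚ.normalize-coprime (1-coprime (suc n))))

  archimedean : ∀ p → ∃ λ n → p < ι n
  archimedean p@(mkℚ i d _) = suc ℤ.∣ i ∣ , subst (p <_) (sym (ι≡ (suc ℤ.∣ i ∣)))
    (ℚ.*<* (subst (ℤ._< + suc ℤ.∣ i ∣ ℤ.* + suc d) (sym (ℤ.*-identityʳ i))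
      (ℤ.≤-<-trans (i≤∣i∣ i) (ℤ.+<+ (ℕ.≤-trans (ℕ.n<1+n _) (ℕ.m≤m*n (suc ℤ.∣ i ∣) (suc d)))))))
    where
    i≤∣i∣ : ∀ i → i ℤ.≤ + ℤ.∣ i ∣
    i≤∣i∣ (+ n)      = ℤ.≤-refl
    i≤∣i∣ (-[1+ n ]) = ℤ.-≤+

-- Two-sided Dedekind cuts of ℚ.

record ℝ : Set₁ where
  field
    L U         : ℚ → Set
    L-inhabited : ∃ L
    U-inhabited : ∃ U
    L-closed    : ∀ {p q} → p < q → L q → L p
    U-closed    : ∀ {p q} → p < q → U p → U q
    L-open      : ∀ {p} → L p → ∃ λ q → p < q × L q
    U-open      : ∀ {q} → U q → ∃ λ p → p < q × U p
    disjoint    : ∀ {q} → L q → U q → ⊥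
    located     : ∀ {p q} → p < q → L p ⊎ U q

  L<U : ∀ {p q} → L p → U q → p < q
  L<U {p} {q} Lp Uq with ℚ.<-cmp p q
  ... | tri< p<q _ _    = p<q
  ... | tri≈ _ refl _   = contradiction Uq (disjoint Lp)
  ... | tri> _ _ q<p    = contradiction Uq (disjoint (L-closed q<p Lp))

infix 4 _≤ᴿ_ _≥ᴿ_

_≤ᴿ_ : ℝ → ℝ → Set
x ≤ᴿ y = ∀ q → ℝ.L x q → ℝ.L y q

_≥ᴿ_ : ℝ → ℝ → Set
x ≥ᴿ y = y ≤ᴿ x

fromℚ : ℚ → ℝ
fromℚ x = record
  { L           = _< x
  ; U           = x <_
  ; L-inhabited = x - 1ℚ , p-1<p x
  ; U-inhabited = x + 1ℚ , p<p+q 0<1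
  ; L-closed    = ℚ.<-trans
  ; U-closed    = λ p<q x<p → ℚ.<-trans x<p p<q
  ; L-open      = λ p<x → let m , p<m , m<x = ℚ.<-dense p<x in m , p<m , m<x
  ; U-open      = λ x<q → let m , x<m , m<q = ℚ.<-dense x<q in m , m<q , x<m
  ; disjoint    = ℚ.<-asym
  ; located     = loc
  }
  where
  loc : ∀ {p q} → p < q → p < x ⊎ x < q
  loc {p} p<q with p ℚ.<? x
  ... | yes p<x = inj₁ p<x
  ... | no  p≮x = inj₂ (ℚ.≤-<-trans (ℚ.≮⇒≥ p≮x) p<q)

fromℕ : ℕ → ℝ
fromℕ n = fromℚ (+ n ℚ./ 1)

record ℝ⁺ : Set₁ where
  constructor _,⁺_
  field
    real     : ℝ
    positive : ℝ.L real 0ℚ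
  open ℝ real public

  L-positive : ∃ λ p → 0ℚ < p × L p
  L-positive = L-open positive

  0<U : ∀ {q} → U q → 0ℚ < q
  0<U = L<U positive

open ℝ⁺ public using (real)

fromℕ⁺ : (n : ℕ) → .{{ℕ.NonZero n}} → ℝ⁺
fromℕ⁺ n@(suc _) = fromℕ n ,⁺ ℚ.positive⁻¹ (+ n ℚ./ 1) {{ℚ.normalize-pos n 1}}

private
  -- Rationals a < x < b with b / a < s / r.
  Ratio : ℝ⁺ → ℚ → ℚ → Set
  Ratio x r s = ∃₂ λ a b → 0ℚ < a × ℝ⁺.L x a × ℝ⁺.U x b × r * b < s * a

  module _ (x : ℝ⁺) {r s l₀ δ} (0<l₀ : 0ℚ < l₀) (Ll₀ : ℝ⁺.L x l₀) (0<r : 0ℚ < r) (r<s : r < s)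
           (0<δ : 0ℚ < δ) (δ*3r≡ : δ * (r + r + r) ≡ (s - r) * l₀) where
    open ℝ⁺ x
    open +-*-Solver

    close : ∀ {l} → l₀ ≤ l → r * (l + δ + δ) < s * l
    close {l} l₀≤l = ℚ.<-≤-trans (p<p+q (*-pos 0<δ 0<r)) (ℚ.≤-trans (ℚ.≤-reflexive eq₁)
      (ℚ.≤-trans (ℚ.+-monoʳ-≤ (r * l) le) (ℚ.≤-reflexive eq₂)))
      where
      eq₁ : r * (l + δ + δ) + δ * r ≡ r * l + δ * (r + r + r)
      eq₁ = solve 3 (λ r l δ → r :* (l :+ δ :+ δ) :+ δ :* r := r :* l :+ δ :* (r :+ r :+ r)) refl r l δ
      le : δ * (r + r + r) ≤ (s - r) * l
      le = subst (_≤ (s - r) * l) (sym δ*3r≡)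
        (ℚ.*-monoˡ-≤-nonNeg (s - r) {{ℚ.nonNegative (ℚ.<⇒≤ (p<q⇒0<q-p r<s))}} l₀≤l)
      eq₂ : r * l + (s - r) * l ≡ s * l
      eq₂ = solve 3 (λ r s l → r :* l :+ (s :- r) :* l := s :* l) refl r s l

    walk : ∀ n {l} → l₀ ≤ l → L l → U (l + ι n * δ) → Ratio x r s
    walk zero {l} _ Ll Ul = contradiction (subst U eq Ul) (disjoint Ll)
      where
      eq : l + 0ℚ * δ ≡ l
      eq = trans (cong (λ z → l + z) (ℚ.*-zeroˡ δ)) (ℚ.+-identityʳ l)
    walk (suc n) {l} l₀≤l Ll Ul = [ continue , stop ]′ (located (p<p+q {l + δ} 0<δ))
      where
      eq : l + (1ℚ + ι n) * δ ≡ l + δ + ι n * δ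
      eq = solve 3 (λ l m δ → l :+ (con 1ℚ :+ m) :* δ := l :+ δ :+ m :* δ) refl l (ι n) δ
      continue : L (l + δ) → Ratio x r s
      continue Ll′ = walk n (ℚ.≤-trans l₀≤l (ℚ.<⇒≤ (p<p+q {l} 0<δ))) Ll′ (subst U eq Ul)
      stop : U (l + δ + δ) → Ratio x r s
      stop Ul″ = l , l + δ + δ , ℚ.<-≤-trans 0<l₀ l₀≤l , Ll , Ul″ , close l₀≤l

    start : ∀ {u t n} → U u → t * δ ≡ u → t < ι n → Ratio x r s
    start {u} {t} {n} Uu tδ≡u t<n = walk n {l₀} ℚ.≤-refl Ll₀ (U-closed u<l₀+nδ Uu)
      where
      u<l₀+nδ : u < l₀ + ι n * δ
      u<l₀+nδ = ℚ.<-trans (subst (_< ι n * δ) tδ≡u (*-monoʳ-< 0<δ t<n))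
        (subst (ι n * δ <_) (ℚ.+-comm (ι n * δ) l₀) (p<p+q 0<l₀))

  abstract
    ratio : ∀ (x : ℝ⁺) {r s} → 0ℚ < r → r < s → Ratio x r s
    ratio x 0<r r<s =
      let l₀ , 0<l₀ , Ll₀ = ℝ⁺.L-positive x
          δ , 0<δ , δ*3r≡ = quotient⁺ (*-pos (p<q⇒0<q-p r<s) 0<l₀) (+-pos (+-pos 0<r 0<r) 0<r)
          u , Uu = ℝ⁺.U-inhabited x
          t , tδ≡u = quotient u 0<δ
          n , t<n = archimedean t
      in start x 0<l₀ Ll₀ 0<r r<s 0<δ δ*3r≡ {n = n} Uu tδ≡u t<n

infixl 7 _*ᴿ_ _/ᴿ_

_*ᴿ_ : ℝ⁺ → ℝ⁺ → ℝ⁺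
x *ᴿ y = record
  { L           = Lᴾ
  ; U           = Uᴾ
  ; L-inhabited = 0ℚ , pos
  ; U-inhabited = let a , Ua = X.U-inhabited ; b , Ub = Y.U-inhabited
                  in a * b + 1ℚ , a , b , Ua , Ub , p<p+q 0<1
  ; L-closed    = λ { p<q (a , b , 0<a , 0<b , La , Lb , q<ab) →
                      a , b , 0<a , 0<b , La , Lb , ℚ.<-trans p<q q<ab }
  ; U-closed    = λ { p<q (a , b , Ua , Ub , ab<p) → a , b , Ua , Ub , ℚ.<-trans ab<p p<q }
  ; L-open      = λ { (a , b , 0<a , 0<b , La , Lb , p<ab) →
                      let m , p<m , m<ab = ℚ.<-dense p<ab
                      in m , p<m , a , b , 0<a , 0<b , La , Lb , m<ab }
  ; U-open      = λ { (a , b , Ua , Ub , ab<q) →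
                      let m , ab<m , m<q = ℚ.<-dense ab<q in m , m<q , a , b , Ua , Ub , ab<m }
  ; disjoint    = λ { (a , b , 0<a , 0<b , La , Lb , q<ab) (a′ , b′ , Ua , Ub , ab<q) →
                      ℚ.<-asym (ℚ.<-trans q<ab (*-mono-< 0<a (Y.0<U Ub) (X.L<U La Ua) (Y.L<U Lb Ub)))
                               ab<q }
  ; located     = loc
  } ,⁺ pos
  where
  module X = ℝ⁺ x
  module Y = ℝ⁺ y

  Lᴾ Uᴾ : ℚ → Set
  Lᴾ r = ∃₂ λ a b → 0ℚ < a × 0ℚ < b × X.L a × Y.L b × r < a * b
  Uᴾ r = ∃₂ λ a b → X.U a × Y.U b × a * b < r

  pos : Lᴾ 0ℚ
  pos = let a , 0<a , La = X.L-positive ; b , 0<b , Lb = Y.L-positive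
        in a , b , 0<a , 0<b , La , Lb , *-pos 0<a 0<b

  split : ∀ {r s b b′ t t′} → 0ℚ < b → Y.L b → Y.U b′ → r * b′ < s * b →
          0ℚ < t → t * b ≡ r → t′ * b′ ≡ s → Lᴾ r ⊎ Uᴾ s
  split {r} {s} {b} {b′} {t} {t′} 0<b Lb Ub rb′<sb 0<t tb≡r t′b′≡s =
    [ lower , upper ]′ (X.located t<t′)
    where
    open +-*-Solver
    t<t′ : t < t′
    t<t′ = *-cancelʳ-< (*-pos 0<b (Y.0<U Ub)) (subst₂ _<_
      (trans (cong (_* b′) (sym tb≡r)) (ℚ.*-assoc t b b′))
      (trans (cong (_* b) (sym t′b′≡s))
        (solve 3 (λ t b b′ → t :* b′ :* b := t :* (b :* b′)) refl t′ b b′))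
      rb′<sb)
    lower : X.L t → Lᴾ r ⊎ Uᴾ s
    lower Lt = let a , t<a , La = X.L-open Lt in
      inj₁ (a , b , ℚ.<-trans 0<t t<a , 0<b , La , Lb , subst (_< a * b) tb≡r (*-monoʳ-< 0<b t<a))
    upper : X.U t′ → Lᴾ r ⊎ Uᴾ s
    upper Ut′ = let a , a<t′ , Ua = X.U-open Ut′ in
      inj₂ (a , b′ , Ua , Ub , subst (a * b′ <_) t′b′≡s (*-monoʳ-< (Y.0<U Ub) a<t′))

  loc : ∀ {r s} → r < s → Lᴾ r ⊎ Uᴾ s
  loc {r} {s} r<s = case 0ℚ ℚ.<? r of λ where
    (no r≤0) → let a , b , 0<a , 0<b , La , Lb , 0<ab = pos
               in inj₁ (a , b , 0<a , 0<b , La , Lb , ℚ.≤-<-trans (ℚ.≮⇒≥ r≤0) 0<ab)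
    (yes 0<r) →
      let b , b′ , 0<b , Lb , Ub , rb′<sb = ratio y 0<r r<s
          t , 0<t , tb≡r = quotient⁺ 0<r 0<b
          t′ , _ , t′b′≡s = quotient⁺ (ℚ.<-trans 0<r r<s) (Y.0<U Ub)
      in split {t = t} {t′} 0<b Lb Ub rb′<sb 0<t tb≡r t′b′≡s

_/ᴿ_ : ℝ⁺ → ℝ⁺ → ℝ⁺
x /ᴿ y = record
  { L           = Lᴰ
  ; U           = Uᴰ
  ; L-inhabited = 0ℚ , pos
  ; U-inhabited =
      let a , Ua = X.U-inhabited ; b , 0<b , Lb = Y.L-positive ; t , tb≡a+1 = quotient (a + 1ℚ) 0<b
      in t , a , b , 0<b , Ua , Lb , subst (a <_) (sym tb≡a+1) (p<p+q 0<1)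
  ; L-closed    = λ { p<q (a , b , La , Ub , qb<a) →
                      a , b , La , Ub , ℚ.<-trans (*-monoʳ-< (Y.0<U Ub) p<q) qb<a }
  ; U-closed    = λ { p<q (a , b , 0<b , Ua , Lb , a<pb) →
                      a , b , 0<b , Ua , Lb , ℚ.<-trans a<pb (*-monoʳ-< 0<b p<q) }
  ; L-open      = λ {p} → L-open′ {p}
  ; U-open      = λ {q} → U-open′ {q}
  ; disjoint    = λ {q} → disj {q}
  ; located     = loc
  } ,⁺ pos
  where
  module X = ℝ⁺ x
  module Y = ℝ⁺ y

  Lᴰ Uᴰ : ℚ → Set
  Lᴰ r = ∃₂ λ a b → X.L a × Y.U b × r * b < a
  Uᴰ r = ∃₂ λ a b → 0ℚ < b × X.U a × Y.L b × a < r * b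

  pos : Lᴰ 0ℚ
  pos = let a , 0<a , La = X.L-positive ; b , Ub = Y.U-inhabited
        in a , b , La , Ub , subst (_< a) (sym (ℚ.*-zeroˡ b)) 0<a

  L-open′ : ∀ {p} → Lᴰ p → ∃ λ q → p < q × Lᴰ q
  L-open′ {p} (a , b , La , Ub , pb<a) with ℚ.<-dense pb<a
  ... | m , pb<m , m<a with quotient m (Y.0<U Ub)
  ...   | t , tb≡m = t , *-cancelʳ-< (Y.0<U Ub) (subst (p * b <_) (sym tb≡m) pb<m)
                       , a , b , La , Ub , subst (_< a) (sym tb≡m) m<a

  U-open′ : ∀ {q} → Uᴰ q → ∃ λ p → p < q × Uᴰ p
  U-open′ {q} (a , b , 0<b , Ua , Lb , a<qb) with ℚ.<-dense a<qb
  ... | m , a<m , m<qb with quotient m 0<b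
  ...   | t , tb≡m = t , *-cancelʳ-< 0<b (subst (_< q * b) (sym tb≡m) m<qb)
                       , a , b , 0<b , Ua , Lb , subst (a <_) (sym tb≡m) a<m

  disj : ∀ {q} → Lᴰ q → Uᴰ q → ⊥
  disj {q} (a , b , La , Ub , qb<a) (a′ , b′ , 0<b′ , Ua , Lb , a′<qb′) =
    ℚ.<-asym (ℚ.<-trans qb<a (X.L<U La Ua))
             (ℚ.<-trans a′<qb′ (*-monoˡ-< 0<q (Y.L<U Lb Ub)))
    where
    0<q : 0ℚ < q
    0<q = *-cancelʳ-< 0<b′
      (subst (_< q * b′) (sym (ℚ.*-zeroˡ b′)) (ℚ.<-trans (X.0<U Ua) a′<qb′))

  split : ∀ {r s a a′ t t′} → 0ℚ < r → r < s → X.L a → X.U a′ → r * a′ < s * a →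
          0ℚ < t → t * s ≡ a′ → t′ * r ≡ a → Lᴰ r ⊎ Uᴰ s
  split {r} {s} {a} {a′} {t} {t′} 0<r r<s La Ua ra′<sa 0<t ts≡a′ t′r≡a =
    [ upper , lower ]′ (Y.located t<t′)
    where
    open +-*-Solver
    0<s : 0ℚ < s
    0<s = ℚ.<-trans 0<r r<s
    t<t′ : t < t′
    t<t′ = *-cancelʳ-< (*-pos 0<r 0<s) (subst₂ _<_
      (trans (cong (r *_) (sym ts≡a′))
        (solve 3 (λ r s t → r :* (t :* s) := t :* (r :* s)) refl r s t))
      (trans (cong (s *_) (sym t′r≡a))
        (solve 3 (λ r s t → s :* (t :* r) := t :* (r :* s)) refl r s t′))
      ra′<sa)
    upper : Y.L t → Lᴰ r ⊎ Uᴰ s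
    upper Lt = let b , t<b , Lb = Y.L-open Lt in
      inj₂ (a′ , b , ℚ.<-trans 0<t t<b , Ua , Lb ,
        subst₂ _<_ ts≡a′ (ℚ.*-comm b s) (*-monoʳ-< 0<s t<b))
    lower : Y.U t′ → Lᴰ r ⊎ Uᴰ s
    lower Ut′ = let b , b<t′ , Ub = Y.U-open Ut′ in
      inj₁ (a , b , La , Ub , subst₂ _<_ (ℚ.*-comm b r) t′r≡a (*-monoʳ-< 0<r b<t′))

  loc : ∀ {r s} → r < s → Lᴰ r ⊎ Uᴰ s
  loc {r} {s} r<s = case 0ℚ ℚ.<? r of λ where
    (no r≤0) → let a , b , La , Ub , 0b<a = pos in inj₁ (a , b , La , Ub ,
      ℚ.≤-<-trans (ℚ.*-monoʳ-≤-nonNeg b {{ℚ.nonNegative (ℚ.<⇒≤ (Y.0<U Ub))}} (ℚ.≮⇒≥ r≤0)) 0b<a)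
    (yes 0<r) →
      let a , a′ , 0<a , La , Ua , ra′<sa = ratio x 0<r r<s
          t , 0<t , ts≡a′ = quotient⁺ (X.0<U Ua) (ℚ.<-trans 0<r r<s)
          t′ , _ , t′r≡a = quotient⁺ 0<a 0<r
      in split {t = t} {t′} 0<r r<s La Ua ra′<sa 0<t ts≡a′ t′r≡a

-- r < x^{1/k} iff r < s for some s > 0 with s^k < x: the intermediate s makes the cut
-- open and admits negative r.
root : (k : ℕ) → .{{ℕ.NonZero k}} → ℝ⁺ → ℝ⁺
root k@(suc k-1) x = record
  { L           = Lᴿ
  ; U           = Uᴿ
  ; L-inhabited = 0ℚ , pos
  ; U-inhabited =
      let u , Uu = U-inhabited ; 1<1+u = p<p+q (0<U Uu)
          u<1+u = subst (u <_) (ℚ.+-comm u 1ℚ) (p<p+q 0<1)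
      in 1ℚ + u + 1ℚ , 1ℚ + u , p<p+q 0<1 , ℚ.<-trans 0<1 1<1+u
         , U-closed (ℚ.<-≤-trans u<1+u (^-large k-1 1<1+u)) Uu
  ; L-closed    = λ { p<q (s , q<s , 0<s , Ls) → s , ℚ.<-trans p<q q<s , 0<s , Ls }
  ; U-closed    = λ { p<q (s , s<p , 0<s , Us) → s , ℚ.<-trans s<p p<q , 0<s , Us }
  ; L-open      = λ { (s , p<s , 0<s , Ls) →
                      let m , p<m , m<s = ℚ.<-dense p<s in m , p<m , s , m<s , 0<s , Ls }
  ; U-open      = λ { (s , s<q , 0<s , Us) →
                      let m , s<m , m<q = ℚ.<-dense s<q in m , m<q , s , s<m , 0<s , Us }
  ; disjoint    = λ { (s , q<s , 0<s , Ls) (t , t<q , 0<t , Ut) →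
                      ℚ.<-asym (^-mono-< k-1 0<t (ℚ.<-trans t<q q<s)) (L<U Ls Ut) }
  ; located     = loc
  } ,⁺ pos
  where
  open ℝ⁺ x

  Lᴿ Uᴿ : ℚ → Set
  Lᴿ r = ∃ λ s → r < s × 0ℚ < s × L (s ^ k)
  Uᴿ r = ∃ λ s → s < r × 0ℚ < s × U (s ^ k)

  pos : Lᴿ 0ℚ
  pos = let l , 0<l , Ll = L-positive ; m , 0<m , m<l , m<1 = below-both 0<l 0<1
        in m , 0<m , 0<m , L-closed (ℚ.≤-<-trans (^-small k-1 0<m m<1) m<l) Ll

  loc : ∀ {r s} → r < s → Lᴿ r ⊎ Uᴿ s
  loc {r} r<s with r ℚ.<? 0ℚ
  ... | yes r<0 = let m , 0<m , _ , Lm = pos in inj₁ (m , ℚ.<-trans r<0 0<m , 0<m , Lm)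
  ... | no  r≮0 with ℚ.<-dense r<s
  ...   | b , r<b , b<s with ℚ.<-dense r<b
  ...     | a , r<a , a<b
      with located (^-mono-< k-1 (ℚ.≤-<-trans (ℚ.≮⇒≥ r≮0) r<a) a<b)
  ...       | inj₁ La = inj₁ (a , r<a , ℚ.≤-<-trans (ℚ.≮⇒≥ r≮0) r<a , La)
  ...       | inj₂ Ub = inj₂ (b , b<s , ℚ.≤-<-trans (ℚ.≮⇒≥ r≮0) (ℚ.<-trans r<a a<b) , Ub)

_^ℕ_ : ℝ⁺ → ℕ → ℝ⁺
x ^ℕ zero  = fromℕ⁺ 1
x ^ℕ suc n = x *ᴿ (x ^ℕ n)

infixr 8 _^ᴿ_

-- The exponent m / d is not required to be in lowest terms.
_^ᴿ_ : ℝ⁺ → ℚᵘ → ℝ⁺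
x ^ᴿ mkℚᵘ (+ m)      d-1 = root (suc d-1) (x ^ℕ m)
x ^ᴿ mkℚᵘ (-[1+ m ]) d-1 = fromℕ⁺ 1 /ᴿ root (suc d-1) (x ^ℕ suc m)

record SimpleGraph (n : ℕ) : Set₁ where
  infix 4 _~_ _~?_
  field
    _~_      : Rel (Fin n) 0ℓ
    ~-sym    : Symmetric _~_
    ~-irrefl : ∀ {v} → ¬ v ~ v
    _~?_     : Decidable _~_

module _ {n} (G : SimpleGraph n) where
  open SimpleGraph G

  N⟨_⟩ : Fin n → Subset n
  N⟨ v ⟩ = Vec.tabulate (λ u → does (v ~? u))

  N[_] : Fin n → Subset n
  N[ v ] = ⁅ v ⁆ ∪ N⟨ v ⟩

  degree : Fin n → ℕ
  degree v = ∣ N⟨ v ⟩ ∣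

  Δ : ℕ
  Δ = max 0 (List.tabulate degree)

  IsLimitedPacking : ℕ → Subset n → Set
  IsLimitedPacking k X = ∀ v → ∣ N[ v ] ∩ X ∣ ℕ.≤ k

IsLargest : ∀ {n} → (Subset n → Set) → Subset n → Set
IsLargest P X = P X × (∀ Y → P Y → ∣ Y ∣ ℕ.≤ ∣ X ∣)

largest : ∀ {n} {P : Subset n → Set} → Unary.Decidable P → ∃ P → ∃ (IsLargest P)
largest {n} {P} P? (X₀ , PX₀) = go n (λ Y _ → ∣p∣≤n Y)
  where
  go : ∀ m → (∀ Y → P Y → ∣ Y ∣ ℕ.≤ m) → ∃ (IsLargest P)
  go zero    bound = X₀ , PX₀ , λ Y PY → ℕ.≤-trans (bound Y PY) z≤n
  go (suc m) bound with anySubset? (λ Y → P? Y ×-dec (suc m ℕ.≤? ∣ Y ∣))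
  ... | yes (X , PX , m<X) = X , PX , λ Y PY → ℕ.≤-trans (bound Y PY) m<X
  ... | no  none           = go m (λ Y PY → ℕ.≤-pred (ℕ.≰⇒> (λ m<Y → none (Y , PY , m<Y))))

module _ {n} (k : ℕ) (G : SimpleGraph n) where

  largest-limitedPacking : ∃ (IsLargest (IsLimitedPacking G k))
  largest-limitedPacking = largest
    (λ X → all? (λ v → ∣ N[_] G v ∩ X ∣ ℕ.≤? k))
    (Subset.⊥ , λ v → subst (ℕ._≤ k) (sym (trans (cong ∣_∣ (∩-zeroʳ (N[_] G v))) (∣⊥∣≡0 n))) z≤n)

  limitedPackingNumber : ℕ
  limitedPackingNumber = ∣ proj₁ largest-limitedPacking ∣

order-nonZero : ∀ {n} (G : SimpleGraph n) {k} .{{_ : ℕ.NonZero k}} → k ℕ.≤ Δ G → ℕ.NonZero n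
order-nonZero {zero}  G {suc _} ()
order-nonZero {suc n} G k≤Δ = _

C-nonZero : ∀ {n k} → k ℕ.≤ n → ℕ.NonZero (n C k)
C-nonZero k≤n = ℕ.>-nonZero (C-pos k≤n)
  where
  C-pos : ∀ {n k} → k ℕ.≤ n → 0 ℕ.< n C k
  C-pos z≤n = s≤s z≤n
  C-pos {suc n} {suc k} (s≤s k≤n) = subst (0 ℕ.<_) (nCk+nC[k+1]≡[n+1]C[k+1] n k)
    (ℕ.≤-trans (C-pos k≤n) (ℕ.m≤m+n (n C k) _))

{-# OPTIONS --safe #-}
module Submission where

-- Choose every vertex independently with probability p. A chosen set A contains a k-limited
-- packing X with |A| ≤ |X| + Σ_v C(|N[v] ∩ A|, k+1): deleting a vertex from N[v] ∩ A whenever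
-- |N[v] ∩ A| > k lowers the sum. Taking expectations, n p ≤ L_k(G) + n c̃ p^{k+1}. Each rational
-- upper bound b of the denominator satisfies c̃ (1+k)^{k+1} < b^k, and p = (1+k)/b then gives
-- k n ≤ L_k(G) b.

open import Defs
open import Data.Nat using (ℕ; suc; s≤s; _+_; _≤_; NonZero)
open import Data.Nat.Combinatorics using (_C_)
open import Data.Integer as ℤ using ()
open import Data.Rational.Unnormalised as ℚᵘ using (ℚᵘ; 1ℚᵘ)

import Algebra.Definitions.RawMonoid
import Algebra.Properties.CommutativeSemiring.Exp
import Algebra.Properties.Semiring.Mult
open import Algebra.Bundles using (CommutativeRing)
open import Data.Fin using (Fin; zero; suc)
import Data.Fin.Properties as Fin
open import Data.Fin.Subset as Subset using (Subset; ⁅_⁆; _∪_; _∩_; _⊆_; _∈_; ∣_∣; inside; outside)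
open import Data.Fin.Subset.Properties
open import Data.Integer using (+_)
import Data.Integer.Properties as ℤ
import Data.List as List
open import Data.List.Extrema.Nat using (xs≤max)
import Data.List.Relation.Unary.All.Properties as All
open import Data.Nat as ℕ using (zero; z≤n; _<_)
open import Data.Nat.Combinatorics
  using (nC1≡n; nCn≡1; nCk≡nC[n∸k]; nCk+nC[k+1]≡[n+1]C[k+1]; k>n⇒nCk≡0)
import Data.Nat.Coprimality as Coprime
import Data.Nat.Properties as ℕ
open import Data.Product using (∃; _×_; _,_; proj₁; proj₂)
open import Data.Rational as ℚ using (ℚ; 0ℚ; 1ℚ; mkℚ)
import Data.Rational.Properties as ℚ
open import Data.Rational.Solver using (module +-*-Solver)
open import Data.Sum using (inj₁; inj₂)
open import Data.Vec using ([]; _∷_; there)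
open import Function using (_∘_)
open import Relation.Binary.PropositionalEquality
  using (_≡_; refl; sym; trans; cong; cong₂; subst; subst₂; module ≡-Reasoning)
open import Relation.Nullary using (yes; no; contradiction)

open Algebra.Definitions.RawMonoid ℕ.+-0-rawMonoid using (sum)
open Algebra.Properties.CommutativeSemiring.Exp
  (CommutativeRing.commutativeSemiring ℚ.+-*-commutativeRing) using (_^_; ^-distrib-*)
open Algebra.Properties.Semiring.Mult
  (CommutativeRing.semiring ℚ.+-*-commutativeRing) using (×-homo-+) renaming (_×_ to _·_)

-- Monotonicity of finite sums and binomial coefficients.

sum-mono-≤ : ∀ {m} {f g : Fin m → ℕ} → (∀ i → f i ≤ g i) → sum f ≤ sum g
sum-mono-≤ {zero}  f≤g = z≤n
sum-mono-≤ {suc m} f≤g = ℕ.+-mono-≤ (f≤g zero) (sum-mono-≤ (f≤g ∘ suc))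

sum-mono-< : ∀ {m} {f g : Fin m → ℕ} → (∀ i → f i ≤ g i) → ∀ i → f i < g i → sum f < sum g
sum-mono-< f≤g zero    fi<gi = ℕ.+-mono-<-≤ fi<gi (sum-mono-≤ (f≤g ∘ suc))
sum-mono-< f≤g (suc i) fi<gi = ℕ.+-mono-≤-< (f≤g zero) (sum-mono-< (f≤g ∘ suc) i fi<gi)

nC0≡1 : ∀ n → n C 0 ≡ 1
nC0≡1 n = trans (nCk≡nC[n∸k] {0} {n} z≤n) (nCn≡1 n)

C-suc-≤ : ∀ n k → n C suc k ≤ suc n C suc k
C-suc-≤ n k = subst (n C suc k ≤_) (nCk+nC[k+1]≡[n+1]C[k+1] n k) (ℕ.m≤n+m (n C suc k) (n C k))

C-monoˡ-≤ : ∀ {m n} k → m ≤ n → m C suc k ≤ n C suc k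
C-monoˡ-≤ k m≤n = go (ℕ.≤⇒≤′ m≤n)
  where
  go : ∀ {m n} → m ℕ.≤′ n → m C suc k ≤ n C suc k
  go (ℕ.≤′-reflexive refl)       = ℕ.≤-refl
  go {n = suc n} (ℕ.≤′-step m≤n) = ℕ.≤-trans (go m≤n) (C-suc-≤ n k)

-- In Pascal's rule the extra term `n C k` is positive once k is at most the predecessor of the
-- larger argument. For smaller arguments both sides would be 0.
C-monoˡ-< : ∀ {m n k} → m < n → k < n → m C suc k < n C suc k
C-monoˡ-< {m} {suc n} {k} (s≤s m≤n) (s≤s k≤n) = begin-strict
  m C suc k             ≤⟨ C-monoˡ-≤ k m≤n ⟩
  -- `0 < n C k` unfolds to `1 ≤ n C k`, so weak monotonicity of addition already yields the strict
  -- step.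
  n C suc k             <⟨ ℕ.+-monoˡ-≤ (n C suc k) (ℕ.>-nonZero⁻¹ (n C k) {{C-nonZero k≤n}}) ⟩
  n C k + n C suc k     ≡⟨ nCk+nC[k+1]≡[n+1]C[k+1] n k ⟩
  suc n C suc k         ∎
  where open ℕ.≤-Reasoning

-- Sizes of finite subsets.

∣p∪q∣≤∣p∣+∣q∣ : ∀ {n} (p q : Subset n) → ∣ p ∪ q ∣ ≤ ∣ p ∣ + ∣ q ∣
∣p∪q∣≤∣p∣+∣q∣ []            []            = z≤n
∣p∪q∣≤∣p∣+∣q∣ (inside  ∷ p) (inside  ∷ q) =
  s≤s (ℕ.≤-trans (∣p∪q∣≤∣p∣+∣q∣ p q) (ℕ.+-monoʳ-≤ ∣ p ∣ (ℕ.n≤1+n ∣ q ∣)))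
∣p∪q∣≤∣p∣+∣q∣ (inside  ∷ p) (outside ∷ q) = s≤s (∣p∪q∣≤∣p∣+∣q∣ p q)
∣p∪q∣≤∣p∣+∣q∣ (outside ∷ p) (inside  ∷ q) =
  subst (suc ∣ p ∪ q ∣ ≤_) (sym (ℕ.+-suc ∣ p ∣ ∣ q ∣)) (s≤s (∣p∪q∣≤∣p∣+∣q∣ p q))
∣p∪q∣≤∣p∣+∣q∣ (outside ∷ p) (outside ∷ q) = ∣p∪q∣≤∣p∣+∣q∣ p q

∣⁅x⁆∪p∣≤1+∣p∣ : ∀ {n} (x : Fin n) p → ∣ ⁅ x ⁆ ∪ p ∣ ≤ suc ∣ p ∣
∣⁅x⁆∪p∣≤1+∣p∣ x p = subst (λ s → ∣ ⁅ x ⁆ ∪ p ∣ ≤ s + ∣ p ∣) (∣⁅x⁆∣≡1 x) (∣p∪q∣≤∣p∣+∣q∣ ⁅ x ⁆ p)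

∣p∣≤1+∣p-x∣ : ∀ {n} (p : Subset n) x → ∣ p ∣ ≤ suc ∣ p Subset.- x ∣
∣p∣≤1+∣p-x∣ p x = ℕ.≤-trans (p⊆q⇒∣p∣≤∣q∣ p⊆) (∣⁅x⁆∪p∣≤1+∣p∣ x (p Subset.- x))
  where
  p⊆ : p ⊆ ⁅ x ⁆ ∪ (p Subset.- x)
  p⊆ {y} y∈p with y Fin.≟ x
  ... | yes refl = x∈p∪q⁺ (inj₁ (x∈⁅x⁆ x))
  ... | no  y≢x  = x∈p∪q⁺ (inj₂ (x∈p∧x≢y⇒x∈p-y y∈p y≢x))

∣p∣>0⇒∃∈ : ∀ {n} (p : Subset n) → 0 < ∣ p ∣ → ∃ (_∈ p)
∣p∣>0⇒∃∈ {n} p 0<∣p∣ with nonempty? p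
... | yes p≢∅ = p≢∅
... | no  p≡∅ = contradiction (subst (0 <_) (trans (cong ∣_∣ (Empty-unique p≡∅)) (∣⊥∣≡0 n)) 0<∣p∣) λ()

x∉p-x : ∀ {n} (p : Subset n) x → x Subset.∉ p Subset.- x
x∉p-x (_ ∷ p) (suc x) (there x∈p-x) = x∉p-x p x x∈p-x

-- Pruning a vertex set to a limited packing.

module _ {m n} (N : Fin m → Subset n) (k : ℕ) where

  -- Counts pairs of an index v and a (k+1)-subset of `N v ∩ A`; it vanishes exactly when no `N v`
  -- meets A in more than k points.
  excess : Subset n → ℕ
  excess A = sum (λ v → ∣ N v ∩ A ∣ C suc k)

  private
    -- Any x in `N v ∩ A` works: no intersection grows, and the one at v loses a point while its
    -- size exceeds k, so its binomial coefficient drops.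
    deletion : ∀ {v A} → k < ∣ N v ∩ A ∣ → ∃ λ x → excess (A Subset.- x) < excess A
    deletion {v} {A} k<∣N∩A∣ = x , sum-mono-<
      (λ u → C-monoˡ-≤ k (p⊆q⇒∣p∣≤∣q∣ (shrink u))) v
      (C-monoˡ-< (p⊂q⇒∣p∣<∣q∣ (shrink v , x , x∈N∩A , x∉)) k<∣N∩A∣)
      where
      nonempty = ∣p∣>0⇒∃∈ (N v ∩ A) (ℕ.≤-<-trans z≤n k<∣N∩A∣)
      x = proj₁ nonempty
      x∈N∩A = proj₂ nonempty
      shrink : ∀ u → N u ∩ (A Subset.- x) ⊆ N u ∩ A
      shrink u y∈ = let y∈N , y∈A-x = x∈p∩q⁻ (N u) (A Subset.- x) y∈
                    in x∈p∩q⁺ (y∈N , p─q⊆p A ⁅ x ⁆ y∈A-x)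
      x∉ : x Subset.∉ N v ∩ (A Subset.- x)
      x∉ x∈ = x∉p-x A x (proj₂ (x∈p∩q⁻ (N v) (A Subset.- x) x∈))

  -- Each deletion costs one vertex and lowers `excess` by at least one, so the difference `∣ A ∣`
  -- minus `excess A` never decreases. The recursion runs on a bound e for the excess.
  prune : ∀ A → ∃ λ X → (∀ v → ∣ N v ∩ X ∣ ≤ k) × ∣ A ∣ ≤ ∣ X ∣ + excess A
  prune A = go (excess A) A ℕ.≤-refl
    where
    go : ∀ e A → excess A ≤ e → ∃ λ X → (∀ v → ∣ N v ∩ X ∣ ≤ k) × ∣ A ∣ ≤ ∣ X ∣ + excess A
    go e A excess≤e with Fin.all? (λ v → ∣ N v ∩ A ∣ ℕ.≤? k)
    ... | yes ok = A , ok , ℕ.m≤m+n ∣ A ∣ (excess A)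
    ... | no  ¬ok with Fin.¬∀⟶∃¬ m _ (λ v → ∣ N v ∩ A ∣ ℕ.≤? k) ¬ok
    ...   | v , v-bad with deletion {v} {A} (ℕ.≰⇒> v-bad)
    -- The excess is already 0 and cannot drop further.
    go zero    A excess≤e | no _ | _ | x , less = contradiction (ℕ.<-≤-trans less excess≤e) λ()
    go (suc e) A excess≤e | no _ | _ | x , less
      with go e (A Subset.- x) (ℕ.≤-pred (ℕ.≤-trans less excess≤e))
    ... | X , ok , A-x≤ = X , ok , (begin
      ∣ A ∣                                     ≤⟨ ∣p∣≤1+∣p-x∣ A x ⟩
      suc ∣ A Subset.- x ∣                      ≤⟨ s≤s A-x≤ ⟩
      suc (∣ X ∣ + excess (A Subset.- x))       ≡⟨ ℕ.+-suc ∣ X ∣ _ ⟨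
      ∣ X ∣ + suc (excess (A Subset.- x))       ≤⟨ ℕ.+-monoʳ-≤ ∣ X ∣ less ⟩
      ∣ X ∣ + excess A                          ∎)
      where open ℕ.≤-Reasoning

-- Naturals inside the rationals, and inequalities between products and powers.

-- As an n-fold sum of `1ℚ`, `ι (suc n)` unfolds to `1ℚ ℚ.+ ι n`, which suits induction; `n/1≡ι`
-- links it to the fraction inside `fromℕ`.
ι : ℕ → ℚ
ι n = n · 1ℚ

n/1≡ι : ∀ n → (+ n) ℚ./ 1 ≡ ι n
n/1≡ι n = trans (ℚ.normalize-coprime (coprime n)) (sym (ι≡mkℚ n))
  where
  coprime : ∀ n → Coprime.Coprime n 1
  coprime n = Coprime.sym (Coprime.1-coprimeTo n)
  ι≡mkℚ : ∀ n → ι n ≡ mkℚ (+ n) 0 (coprime n)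
  ι≡mkℚ zero    = refl
  ι≡mkℚ (suc n) = trans (cong (1ℚ ℚ.+_) (ι≡mkℚ n))
    (trans (ℚ./-cong {q₁ = 1} {q₂ = 1} (cong (λ i → (+ 1) ℤ.+ i) (ℤ.*-identityʳ (+ n))) refl)
           (ℚ.normalize-coprime (coprime (suc n))))

ι-+ : ∀ m n → ι (m + n) ≡ ι m ℚ.+ ι n
ι-+ = ×-homo-+ 1ℚ

0≤ι : ∀ n → 0ℚ ℚ.≤ ι n
0≤ι zero    = ℚ.≤-refl
0≤ι (suc n) = ℚ.+-mono-≤ (ℚ.nonNegative⁻¹ 1ℚ) (0≤ι n)

ι-mono-≤ : ∀ {m n} → m ≤ n → ι m ℚ.≤ ι n
ι-mono-≤ {n = n} z≤n = 0≤ι n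
ι-mono-≤ (s≤s m≤n)   = ℚ.+-monoʳ-≤ 1ℚ (ι-mono-≤ m≤n)

1≤ι : ∀ n .{{_ : NonZero n}} → 1ℚ ℚ.≤ ι n
1≤ι n = ι-mono-≤ (ℕ.>-nonZero⁻¹ n)

0<1 : 0ℚ ℚ.< 1ℚ
0<1 = ℚ.positive⁻¹ 1ℚ

0<ι : ∀ n .{{_ : NonZero n}} → 0ℚ ℚ.< ι n
0<ι n = ℚ.<-≤-trans 0<1 (1≤ι n)

*-monoʳ-≤ : ∀ {p q r} → 0ℚ ℚ.≤ r → p ℚ.≤ q → p ℚ.* r ℚ.≤ q ℚ.* r
*-monoʳ-≤ {r = r} 0≤r = ℚ.*-monoʳ-≤-nonNeg r {{ℚ.nonNegative 0≤r}}

*-monoˡ-≤ : ∀ {p q r} → 0ℚ ℚ.≤ r → p ℚ.≤ q → r ℚ.* p ℚ.≤ r ℚ.* q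
*-monoˡ-≤ {r = r} 0≤r = ℚ.*-monoˡ-≤-nonNeg r {{ℚ.nonNegative 0≤r}}

*-mono-< : ∀ {p q r s} → 0ℚ ℚ.≤ p → 0ℚ ℚ.≤ r → p ℚ.< q → r ℚ.< s → p ℚ.* r ℚ.< q ℚ.* s
*-mono-< {p} {q} {r} {s} 0≤p 0≤r p<q r<s = ℚ.≤-<-trans (*-monoˡ-≤ 0≤p (ℚ.<⇒≤ r<s))
  (ℚ.*-monoˡ-<-pos s {{ℚ.positive (ℚ.≤-<-trans 0≤r r<s)}} p<q)

*-pos : ∀ {p q} → 0ℚ ℚ.< p → 0ℚ ℚ.< q → 0ℚ ℚ.< p ℚ.* q
*-pos = *-mono-< ℚ.≤-refl ℚ.≤-refl

^-pos : ∀ {p} n → 0ℚ ℚ.< p → 0ℚ ℚ.< p ^ n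
^-pos zero    0<p = 0<1
^-pos (suc n) 0<p = *-pos 0<p (^-pos n 0<p)

^-mono-< : ∀ {p q} n → 0ℚ ℚ.< p → p ℚ.< q → p ^ suc n ℚ.< q ^ suc n
^-mono-< {p} {q} zero    0<p p<q = subst₂ ℚ._<_ (sym (ℚ.*-identityʳ p)) (sym (ℚ.*-identityʳ q)) p<q
^-mono-< (suc n) 0<p p<q =
  *-mono-< (ℚ.<⇒≤ 0<p) (ℚ.<⇒≤ (^-pos (suc n) 0<p)) p<q (^-mono-< n 0<p p<q)

^-cancel-≤ : ∀ {p q} n → 0ℚ ℚ.< q → p ^ suc n ℚ.≤ q ^ suc n → p ℚ.≤ q
^-cancel-≤ n 0<q pⁿ≤qⁿ = ℚ.≮⇒≥ λ q<p → ℚ.<-irrefl refl (ℚ.<-≤-trans (^-mono-< n 0<q q<p) pⁿ≤qⁿ)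

-- Expectation over a random subset.

-- 𝔼 p f is the expectation of f A over a random A that contains each point
-- independently with probability p.
𝔼 : ∀ {n} → ℚ → (Subset n → ℚ) → ℚ
𝔼 {zero}  p f = f []
𝔼 {suc n} p f = p ℚ.* 𝔼 p (f ∘ (inside ∷_)) ℚ.+ (1ℚ ℚ.- p) ℚ.* 𝔼 p (f ∘ (outside ∷_))

module _ (p : ℚ) where
  open +-*-Solver

  𝔼-cong : ∀ {n} {f g : Subset n → ℚ} → (∀ A → f A ≡ g A) → 𝔼 p f ≡ 𝔼 p g
  𝔼-cong {zero}  f≡g = f≡g []
  𝔼-cong {suc n} f≡g = cong₂ (λ x y → p ℚ.* x ℚ.+ (1ℚ ℚ.- p) ℚ.* y)
    (𝔼-cong (f≡g ∘ (inside ∷_))) (𝔼-cong (f≡g ∘ (outside ∷_)))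

  average : ∀ x → p ℚ.* x ℚ.+ (1ℚ ℚ.- p) ℚ.* x ≡ x
  average = solve 2 (λ p x → p :* x :+ (con 1ℚ :- p) :* x := x) refl p

  𝔼-const : ∀ n c → 𝔼 {n} p (λ _ → c) ≡ c
  𝔼-const zero    c = refl
  𝔼-const (suc n) c rewrite 𝔼-const n c = average c

  𝔼-+ : ∀ {n} (f g : Subset n → ℚ) → 𝔼 p (λ A → f A ℚ.+ g A) ≡ 𝔼 p f ℚ.+ 𝔼 p g
  𝔼-+ {zero}  f g = refl
  𝔼-+ {suc n} f g
    rewrite 𝔼-+ (f ∘ (inside ∷_)) (g ∘ (inside ∷_))
          | 𝔼-+ (f ∘ (outside ∷_)) (g ∘ (outside ∷_)) =
    solve 5 (λ p a b c d → p :* (a :+ b) :+ (con 1ℚ :- p) :* (c :+ d)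
                        := p :* a :+ (con 1ℚ :- p) :* c :+ (p :* b :+ (con 1ℚ :- p) :* d))
      refl p _ _ _ _

  -- Each j-subset of N lies in A with probability p^j. The induction conditions on the first point:
  -- if it belongs to N, Pascal's rule separates the subsets that contain it, which contribute one
  -- more factor p.
  𝔼-C : ∀ {n} (N : Subset n) j → 𝔼 p (λ A → ι (∣ N ∩ A ∣ C j)) ≡ ι (∣ N ∣ C j) ℚ.* p ^ j
  𝔼-C {n} N zero = begin
    𝔼 p (λ A → ι (∣ N ∩ A ∣ C 0))  ≡⟨ 𝔼-cong (λ A → cong ι (nC0≡1 ∣ N ∩ A ∣)) ⟩
    𝔼 {n} p (λ _ → ι 1)            ≡⟨ 𝔼-const n (ι 1) ⟩
    ι 1                            ≡⟨ cong ι (nC0≡1 ∣ N ∣) ⟨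
    ι (∣ N ∣ C 0)                  ≡⟨ ℚ.*-identityʳ _ ⟨
    ι (∣ N ∣ C 0) ℚ.* p ^ 0        ∎
    where open ≡-Reasoning
  𝔼-C []            (suc j) rewrite k>n⇒nCk≡0 {0} {suc j} (s≤s z≤n) = sym (ℚ.*-zeroˡ (p ^ suc j))
  -- A point outside N leaves `N ∩ A` the same size whether chosen or not, so both branches agree.
  𝔼-C (outside ∷ N) (suc j) = trans (average _) (𝔼-C N (suc j))
  𝔼-C (inside ∷ N)  (suc j) = begin
    p ℚ.* 𝔼 p (λ A → ι (suc ∣ N ∩ A ∣ C suc j)) ℚ.+ (1ℚ ℚ.- p) ℚ.* E₁
      ≡⟨ cong (λ x → p ℚ.* x ℚ.+ (1ℚ ℚ.- p) ℚ.* E₁)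
           (trans (𝔼-cong (λ A → pascal ∣ N ∩ A ∣))
             (𝔼-+ (λ A → ι (∣ N ∩ A ∣ C j)) (λ A → ι (∣ N ∩ A ∣ C suc j)))) ⟩
    p ℚ.* (E₀ ℚ.+ E₁) ℚ.+ (1ℚ ℚ.- p) ℚ.* E₁
      ≡⟨ solve 3 (λ p x y → p :* (x :+ y) :+ (con 1ℚ :- p) :* y := p :* x :+ y) refl p E₀ E₁ ⟩
    p ℚ.* E₀ ℚ.+ E₁
      ≡⟨ cong₂ (λ x y → p ℚ.* x ℚ.+ y) (𝔼-C N j) (𝔼-C N (suc j)) ⟩
    p ℚ.* (ι (∣ N ∣ C j) ℚ.* p ^ j) ℚ.+ ι (∣ N ∣ C suc j) ℚ.* (p ℚ.* p ^ j)
      ≡⟨ solve 4 (λ p x y z → p :* (x :* z) :+ y :* (p :* z) := (x :+ y) :* (p :* z))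
           refl p (ι (∣ N ∣ C j)) (ι (∣ N ∣ C suc j)) (p ^ j) ⟩
    (ι (∣ N ∣ C j) ℚ.+ ι (∣ N ∣ C suc j)) ℚ.* p ^ suc j
      ≡⟨ cong (ℚ._* p ^ suc j) (pascal ∣ N ∣) ⟨
    ι (suc ∣ N ∣ C suc j) ℚ.* p ^ suc j
      ∎
    where
    open ≡-Reasoning
    E₀ = 𝔼 p (λ A → ι (∣ N ∩ A ∣ C j))
    E₁ = 𝔼 p (λ A → ι (∣ N ∩ A ∣ C suc j))
    pascal : ∀ m → ι (suc m C suc j) ≡ ι (m C j) ℚ.+ ι (m C suc j)
    pascal m = trans (cong ι (sym (nCk+nC[k+1]≡[n+1]C[k+1] m j))) (ι-+ (m C j) (m C suc j))

  -- The case j = 1 of `𝔼-C` for the full set, since `∣ A ∣` is `∣ Subset.⊤ ∩ A ∣ C 1`.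
  𝔼-∣∣ : ∀ n → 𝔼 {n} p (λ A → ι ∣ A ∣) ≡ ι n ℚ.* p
  𝔼-∣∣ n = begin
    𝔼 {n} p (λ A → ι ∣ A ∣)                ≡⟨ 𝔼-cong {n} (λ A → cong ι (∣A∣≡ A)) ⟩
    𝔼 {n} p (λ A → ι (∣ Subset.⊤ ∩ A ∣ C 1)) ≡⟨ 𝔼-C (Subset.⊤ {n}) 1 ⟩
    ι (∣ Subset.⊤ {n} ∣ C 1) ℚ.* p ^ 1     ≡⟨ cong₂ (λ m x → ι m ℚ.* x)
                                                (trans (nC1≡n _) (∣⊤∣≡n n)) (ℚ.*-identityʳ p) ⟩
    ι n ℚ.* p                              ∎
    where
    open ≡-Reasoning
    ∣A∣≡ : ∀ A → ∣ A ∣ ≡ ∣ Subset.⊤ ∩ A ∣ C 1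
    ∣A∣≡ A = sym (trans (nC1≡n _) (cong ∣_∣ (∩-identityˡ A)))

  𝔼-sum-≤ : ∀ {m n c} (f : Fin m → Subset n → ℕ) → (∀ i → 𝔼 p (ι ∘ f i) ℚ.≤ c) →
            𝔼 p (λ A → ι (sum (λ i → f i A))) ℚ.≤ ι m ℚ.* c
  𝔼-sum-≤ {zero}  {n} {c} f f≤c = ℚ.≤-reflexive (trans (𝔼-const n 0ℚ) (sym (ℚ.*-zeroˡ c)))
  𝔼-sum-≤ {suc m} {n} {c} f f≤c = begin
    𝔼 p (λ A → ι (f zero A + rest A))           ≡⟨ 𝔼-cong (λ A → ι-+ (f zero A) (rest A)) ⟩
    𝔼 p (λ A → ι (f zero A) ℚ.+ ι (rest A))     ≡⟨ 𝔼-+ (ι ∘ f zero) (ι ∘ rest) ⟩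
    𝔼 p (ι ∘ f zero) ℚ.+ 𝔼 p (ι ∘ rest)         ≤⟨ ℚ.+-mono-≤ (f≤c zero) (𝔼-sum-≤ (f ∘ suc) (f≤c ∘ suc)) ⟩
    c ℚ.+ ι m ℚ.* c                             ≡⟨ solve 2 (λ c m → c :+ m :* c := (con 1ℚ :+ m) :* c) refl c (ι m) ⟩
    ι (suc m) ℚ.* c                             ∎
    where
    open ℚ.≤-Reasoning
    rest : Subset n → ℕ
    rest A = sum (λ i → f (suc i) A)

  module _ (0≤p : 0ℚ ℚ.≤ p) (p≤1 : p ℚ.≤ 1ℚ) where

    𝔼-mono-≤ : ∀ {n} {f g : Subset n → ℚ} → (∀ A → f A ℚ.≤ g A) → 𝔼 p f ℚ.≤ 𝔼 p g
    𝔼-mono-≤ {zero}  f≤g = f≤g []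
    𝔼-mono-≤ {suc n} f≤g = ℚ.+-mono-≤
      (*-monoˡ-≤ 0≤p (𝔼-mono-≤ (f≤g ∘ (inside ∷_))))
      (*-monoˡ-≤ 0≤1-p (𝔼-mono-≤ (f≤g ∘ (outside ∷_))))
      where
      0≤1-p : 0ℚ ℚ.≤ 1ℚ ℚ.- p
      0≤1-p = subst (ℚ._≤ 1ℚ ℚ.- p) (ℚ.+-inverseʳ p) (ℚ.+-monoˡ-≤ (ℚ.- p) p≤1)

    -- Take expectations in the inequality of `prune`, with L bounding the pruned set; `𝔼-C`
    -- evaluates each term of the excess.
    excess-bound : ∀ {m n} (N : Fin m → Subset n) k {c L} → (∀ v → ∣ N v ∣ C suc k ≤ c) →
      (∀ X → (∀ v → ∣ N v ∩ X ∣ ≤ k) → ∣ X ∣ ≤ L) →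
      ι n ℚ.* p ℚ.≤ ι L ℚ.+ ι m ℚ.* (ι c ℚ.* p ^ suc k)
    excess-bound {m} {n} N k {c} {L} N≤c X≤L = begin
      ι n ℚ.* p                                     ≡⟨ 𝔼-∣∣ n ⟨
      𝔼 {n} p (λ A → ι ∣ A ∣)                       ≤⟨ 𝔼-mono-≤ pointwise ⟩
      𝔼 p (λ A → ι L ℚ.+ ι (excess N k A))          ≡⟨ 𝔼-+ (λ _ → ι L) (ι ∘ excess N k) ⟩
      𝔼 {n} p (λ _ → ι L) ℚ.+ 𝔼 p (ι ∘ excess N k)  ≤⟨ ℚ.+-mono-≤ (ℚ.≤-reflexive (𝔼-const n (ι L)))
                                                         (𝔼-sum-≤ (λ v A → ∣ N v ∩ A ∣ C suc k) each) ⟩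
      ι L ℚ.+ ι m ℚ.* (ι c ℚ.* p ^ suc k)           ∎
      where
      open ℚ.≤-Reasoning
      0≤p^ : ∀ j → 0ℚ ℚ.≤ p ^ j
      0≤p^ zero    = ℚ.<⇒≤ 0<1
      0≤p^ (suc j) = subst (ℚ._≤ p ^ suc j) (ℚ.*-zeroʳ p) (*-monoˡ-≤ 0≤p (0≤p^ j))
      pointwise : ∀ A → ι ∣ A ∣ ℚ.≤ ι L ℚ.+ ι (excess N k A)
      pointwise A = let X , ok , A≤ = prune N k A in
        ℚ.≤-trans (ι-mono-≤ (ℕ.≤-trans A≤ (ℕ.+-monoˡ-≤ (excess N k A) (X≤L X ok))))
                  (ℚ.≤-reflexive (ι-+ L (excess N k A)))
      each : ∀ v → 𝔼 p (λ A → ι (∣ N v ∩ A ∣ C suc k)) ℚ.≤ ι c ℚ.* p ^ suc k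
      each v = ℚ.≤-trans (ℚ.≤-reflexive (𝔼-C (N v) (suc k))) (*-monoʳ-≤ (0≤p^ (suc k)) (ι-mono-≤ (N≤c v)))

-- The expectation bound for closed neighbourhoods.

module _ {n} (G : SimpleGraph n) where

  degree≤Δ : ∀ v → degree G v ≤ Δ G
  degree≤Δ = All.tabulate⁻ (xs≤max 0 (List.tabulate (degree G)))

  packing-bound : ∀ k {p} → 0ℚ ℚ.≤ p → p ℚ.≤ 1ℚ →
    ι n ℚ.* p ℚ.≤ ι (limitedPackingNumber k G) ℚ.+ ι n ℚ.* (ι (suc (Δ G) C suc k) ℚ.* p ^ suc k)
  -- A closed neighbourhood has at most Δ + 1 vertices, hence at most `suc (Δ G) C suc k` subsets of
  -- size k + 1.
  packing-bound k {p} 0≤p p≤1 = excess-bound p 0≤p p≤1 (N[_] G) k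
    (λ v → C-monoˡ-≤ k (ℕ.≤-trans (∣⁅x⁆∪p∣≤1+∣p∣ v (N⟨_⟩ G v)) (s≤s (degree≤Δ v))))
    (proj₂ (proj₂ (largest-limitedPacking k G)))

-- Choice of the probability.

-- Multiply the bound by b at p = K/b with K = k + 1. The left side becomes nK = n + kn, the excess
-- term becomes at most n, and n cancels.
optimise : ∀ {n c L b} k .{{_ : NonZero k}} .{{_ : NonZero c}} → 0ℚ ℚ.< b →
  (∀ {p} → 0ℚ ℚ.≤ p → p ℚ.≤ 1ℚ → ι n ℚ.* p ℚ.≤ L ℚ.+ ι n ℚ.* (ι c ℚ.* p ^ suc k)) →
  ι c ℚ.* ι (suc k) ^ suc k ℚ.≤ b ^ k → ι k ℚ.* ι n ℚ.≤ L ℚ.* b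
optimise {n} {c} {L} {b} k@(suc k-1) 0<b bound cKᵏ⁺¹≤bᵏ = +-cancel (ι n) (begin
  ι n ℚ.+ ι k ℚ.* ι n                          ≡⟨ solve 2 (λ n k → n :+ k :* n := n :* (con 1ℚ :+ k)) refl (ι n) (ι k) ⟩
  ι n ℚ.* K                                    ≡⟨ cong (ι n ℚ.*_) pb≡K ⟨
  ι n ℚ.* (p ℚ.* b)                            ≡⟨ ℚ.*-assoc (ι n) p b ⟨
  ι n ℚ.* p ℚ.* b                              ≤⟨ *-monoʳ-≤ (ℚ.<⇒≤ 0<b) (bound 0≤p p≤1) ⟩
  (L ℚ.+ ι n ℚ.* (ι c ℚ.* p ^ suc k)) ℚ.* b    ≡⟨ solve 4 (λ l n x b → (l :+ n :* x) :* b := l :* b :+ n :* (x :* b))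
                                                    refl L (ι n) (ι c ℚ.* p ^ suc k) b ⟩
  L ℚ.* b ℚ.+ ι n ℚ.* (ι c ℚ.* p ^ suc k ℚ.* b) ≤⟨ ℚ.+-monoʳ-≤ (L ℚ.* b) (*-monoˡ-≤ (0≤ι n) cpᵏ⁺¹b≤1) ⟩
  L ℚ.* b ℚ.+ ι n ℚ.* 1ℚ                       ≡⟨ solve 2 (λ x n → x :+ n :* con 1ℚ := n :+ x) refl (L ℚ.* b) (ι n) ⟩
  ι n ℚ.+ L ℚ.* b                              ∎)
  where
  open ℚ.≤-Reasoning
  open +-*-Solver
  instance
    b-pos : ℚ.Positive b
    b-pos = ℚ.positive 0<b
    b≢0 : ℚ.NonZero b
    b≢0 = ℚ.>-nonZero 0<b
    bᵏ-pos : ℚ.Positive (b ^ k)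
    bᵏ-pos = ℚ.positive (^-pos k 0<b)
  K = ι (suc k)
  -- If b were exactly the denominator of the theorem, p would be (c(k+1))^(-1/k), the maximiser of
  -- p - c p^(k+1). A rational b keeps p rational.
  p = K ℚ.* ℚ.1/ b
  pb≡K : p ℚ.* b ≡ K
  pb≡K = trans (ℚ.*-assoc K _ b) (trans (cong (K ℚ.*_) (ℚ.*-inverseˡ b)) (ℚ.*-identityʳ K))
  -- Since c and K are at least 1, dropping them from the hypothesis leaves this; taking k-th roots
  -- then gives K at most b, that is, p at most 1.
  Kᵏ≤bᵏ : K ^ k ℚ.≤ b ^ k
  Kᵏ≤bᵏ = begin
    K ^ k                        ≡⟨ solve 1 (λ x → x := con 1ℚ :* (con 1ℚ :* x)) refl (K ^ k) ⟩
    1ℚ ℚ.* (1ℚ ℚ.* K ^ k)        ≤⟨ *-monoˡ-≤ (ℚ.<⇒≤ 0<1) (*-monoʳ-≤ (ℚ.<⇒≤ (^-pos k (0<ι (suc k)))) (1≤ι (suc k))) ⟩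
    1ℚ ℚ.* K ^ suc k             ≤⟨ *-monoʳ-≤ (ℚ.<⇒≤ (^-pos (suc k) (0<ι (suc k)))) (1≤ι c) ⟩
    ι c ℚ.* K ^ suc k            ≤⟨ cKᵏ⁺¹≤bᵏ ⟩
    b ^ k                        ∎
  p≤1 : p ℚ.≤ 1ℚ
  p≤1 = ℚ.*-cancelʳ-≤-pos b (subst₂ ℚ._≤_ (sym pb≡K) (sym (ℚ.*-identityˡ b)) (^-cancel-≤ k-1 0<b Kᵏ≤bᵏ))
  0≤p : 0ℚ ℚ.≤ p
  0≤p = ℚ.*-cancelʳ-≤-pos b (subst₂ ℚ._≤_ (sym (ℚ.*-zeroˡ b)) (sym pb≡K) (0≤ι (suc k)))
  cpᵏ⁺¹b≤1 : ι c ℚ.* p ^ suc k ℚ.* b ℚ.≤ 1ℚ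
  -- Scaling by b^k completes the power b^(k+1), which combines with p^(k+1) into (pb)^(k+1) =
  -- K^(k+1).
  cpᵏ⁺¹b≤1 = ℚ.*-cancelʳ-≤-pos (b ^ k) (begin
    ι c ℚ.* p ^ suc k ℚ.* b ℚ.* b ^ k    ≡⟨ solve 4 (λ c x b y → c :* x :* b :* y := c :* (x :* (b :* y)))
                                              refl (ι c) (p ^ suc k) b (b ^ k) ⟩
    ι c ℚ.* (p ^ suc k ℚ.* b ^ suc k)    ≡⟨ cong (ι c ℚ.*_) (^-distrib-* p b (suc k)) ⟨
    ι c ℚ.* (p ℚ.* b) ^ suc k            ≡⟨ cong (λ x → ι c ℚ.* x ^ suc k) pb≡K ⟩
    ι c ℚ.* K ^ suc k                    ≤⟨ cKᵏ⁺¹≤bᵏ ⟩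
    b ^ k                                ≡⟨ ℚ.*-identityˡ (b ^ k) ⟨
    1ℚ ℚ.* b ^ k                         ∎)
  +-cancel : ∀ x {y z} → x ℚ.+ y ℚ.≤ x ℚ.+ z → y ℚ.≤ z
  +-cancel x {y} {z} le = subst₂ ℚ._≤_ (lem x y) (lem x z) (ℚ.+-monoʳ-≤ (ℚ.- x) le)
    where
    lem : ∀ x y → ℚ.- x ℚ.+ (x ℚ.+ y) ≡ y
    lem = solve 2 (λ x y → :- x :+ (x :+ y) := y) refl

-- From Dedekind cuts to inequalities between rational powers.

fromℕ⁺-L : ∀ n .{{_ : NonZero n}} {q} → ℝ⁺.L (fromℕ⁺ n) q → q ℚ.< ι n
fromℕ⁺-L n@(suc _) {q} = subst (q ℚ.<_) (n/1≡ι n)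

fromℕ⁺-U : ∀ n .{{_ : NonZero n}} {q} → ℝ⁺.U (fromℕ⁺ n) q → ι n ℚ.< q
fromℕ⁺-U n@(suc _) {q} = subst (ℚ._< q) (n/1≡ι n)

^ℕ-U : ∀ n .{{_ : NonZero n}} m {q} → ℝ⁺.U (fromℕ⁺ n ^ℕ m) q → ι n ^ m ℚ.< q
^ℕ-U n zero    1<q = 1<q
^ℕ-U n (suc m) (a , b , Ua , Ub , ab<q) = ℚ.<-trans
  (*-mono-< (0≤ι n) (ℚ.<⇒≤ (^-pos m (0<ι n))) (fromℕ⁺-U n Ua) (^ℕ-U n m Ub)) ab<q

-- The upper cut of a root supplies s below q whose d-th power exceeds n^m; raising s < q to the
-- power d removes the root.
^ᴿ-U : ∀ n .{{_ : NonZero n}} m d .{{_ : NonZero d}} {q} → ℝ⁺.U (fromℕ⁺ n ^ᴿ ((+ m) ℚᵘ./ d)) q →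
       0ℚ ℚ.< q × ι n ^ m ℚ.< q ^ d
^ᴿ-U n m (suc d-1) (s , s<q , 0<s , Us) =
  ℚ.<-trans 0<s s<q , ℚ.<-trans (^ℕ-U n m Us) (^-mono-< d-1 0<s s<q)

-- `_^ᴿ_` matches on the numerator and denominator of its exponent, so the unnormalised sum must
-- equal this fraction literally before `^ᴿ-U` applies.
1+1/k≡ : ∀ k .{{_ : NonZero k}} → 1ℚᵘ ℚᵘ.+ ((+ 1) ℚᵘ./ k) ≡ ((+ suc k) ℚᵘ./ k)
1+1/k≡ (suc k) rewrite ℕ.+-identityʳ k | ℕ.+-comm k 1 = refl

theorem1 : ∀ {n} (G : SimpleGraph n) (k : ℕ) .{{_ : NonZero k}} (k≤Δ : k ≤ Δ G) →
    let c̃   = fromℕ⁺ (suc (Δ G) C suc k) {{C-nonZero (s≤s k≤Δ)}}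
        n⁺  = fromℕ⁺ n {{order-nonZero G k≤Δ}}
        1/k = (ℤ.+ 1) ℚᵘ./ k
    in fromℕ (limitedPackingNumber k G) ≥ᴿ
         real ((fromℕ⁺ k *ᴿ n⁺) /ᴿ ((c̃ ^ᴿ 1/k) *ᴿ (fromℕ⁺ (1 + k) ^ᴿ (1ℚᵘ ℚᵘ.+ 1/k))))
-- A rational q below the quotient comes with a below kn and b above the denominator such that qb <
-- a; here x, y bound k, n from below and u, v bound the two powers from above.
theorem1 {n} G k k≤Δ q (a , b , (x , y , 0<x , 0<y , x<k , y<n , a<xy) , (u , v , Uu , Uv , uv<b) , qb<a) =
  subst (q ℚ.<_) (sym (n/1≡ι ℓ)) (ℚ.*-cancelʳ-<-nonNeg b (ℚ.<-trans qb<a a<ℓb))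
  where
  ℓ = limitedPackingNumber k G
  c = suc (Δ G) C suc k
  instance
    c≢0 : NonZero c
    c≢0 = C-nonZero (s≤s k≤Δ)
    n≢0 : NonZero n
    n≢0 = order-nonZero G k≤Δ
  -- Besides positivity, these give c < u^k, with c in the form `ι c ^ 1`, and (k+1)^(k+1) < v^k.
  u-bound = ^ᴿ-U c 1 k Uu
  v-bound = ^ᴿ-U (suc k) (suc k) k (subst (λ e → ℝ⁺.U (fromℕ⁺ (suc k) ^ᴿ e) v) (1+1/k≡ k) Uv)
  0<uv : 0ℚ ℚ.< u ℚ.* v
  0<uv = *-pos (proj₁ u-bound) (proj₁ v-bound)
  0<b : 0ℚ ℚ.< b
  0<b = ℚ.<-trans 0<uv uv<b
  instance
    b-nonNeg : ℚ.NonNegative b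
    b-nonNeg = ℚ.nonNegative (ℚ.<⇒≤ 0<b)
  -- Matching on j exposes the successor exponent that `^-mono-<` expects.
  ^-mono-<′ : ∀ j .{{_ : NonZero j}} → (u ℚ.* v) ^ j ℚ.< b ^ j
  ^-mono-<′ (suc j) = ^-mono-< j 0<uv uv<b
  cKᵏ⁺¹≤bᵏ : ι c ℚ.* ι (suc k) ^ suc k ℚ.≤ b ^ k
  cKᵏ⁺¹≤bᵏ = ℚ.<⇒≤ (begin-strict
    ι c ℚ.* ι (suc k) ^ suc k  <⟨ *-mono-< (0≤ι c) (ℚ.<⇒≤ (^-pos (suc k) (0<ι (suc k))))
                                   (subst (ℚ._< u ^ k) (ℚ.*-identityʳ (ι c)) (proj₂ u-bound)) (proj₂ v-bound) ⟩
    u ^ k ℚ.* v ^ k            ≡⟨ ^-distrib-* u v k ⟨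
    (u ℚ.* v) ^ k              <⟨ ^-mono-<′ k ⟩
    b ^ k                      ∎)
    where open ℚ.≤-Reasoning
  -- The chain is a < xy < kn, followed by kn at most ℓb; with qb < a, cancelling b leaves q < ℓ.
  a<ℓb : a ℚ.< ι ℓ ℚ.* b
  a<ℓb = ℚ.<-≤-trans
    (ℚ.<-trans a<xy (*-mono-< (ℚ.<⇒≤ 0<x) (ℚ.<⇒≤ 0<y) (fromℕ⁺-L k x<k) (fromℕ⁺-L n y<n)))
    (optimise {n} {c} {ι ℓ} k 0<b (packing-bound G k) cKᵏ⁺¹≤bᵏ)
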